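{- Let $\mathbb{P}$ be a set of propositional variables and $\phi\in\mathcal{L}^{A,K}(\mathbb{P})$. Then $\phi$ is valid in the class $\mathsf{MRBA^k}$ of modal relativized Boolean algebras satisfying (fk) if and only if $\phi$ is valid in the class $\mathsf{AM}$ of awareness models; that is, $\mathsf{MRBA^k}\models\phi$ iff $\mathsf{AM}\models\phi$.
   Context: Languages. $\mathcal{L}(\mathbb{P})$ has grammar $\phi::=p\mid 1\mid\neg\phi\mid(\phi\land\phi)$, $p\in\mathbb{P}$, with $0\equiv\neg1$, $\phi\lor\psi\equiv\neg(\neg\phi\land\neg\psi)$. $\mathcal{L}^{A,K}(\mathbb{P})$ has grammar $\phi::=p\mid 1\mid\neg\phi\mid(\phi\land\phi)\mid A\phi\mid K\phi$. $\mathcal{L}(\mathbb{P})$ is also regarded as an algebra with operations given by the connectives. Relativized Boolean algebras. An algebra of Boolean similarity type is $\langle RB,\land,\lor,\neg,0,1\rangle$ with $0,1\in RB$, $\land,\lor$ binary and $\neg$ unary. A homomorphism is a map with $h(1)=1'$ respecting $\land,\lor,\neg$ (preservation of $0$ is not required). Write $1_X:=X\lor\neg X$, $0_X:=X\land\neg X$, and $Y\geq X$ iff $X\land Y=X$. A relativized Boolean algebra $\mathbf{RB}$ is such an algebra satisfying: (RB1) $\land,\lor$ are associative, commutative, distributive (each over the other), and with $\neg$ satisfy De Morgan's laws; (RB2) $X\land X=X\lor X=X\land 1=\neg\neg X=X$; (RB3) $X\lor 1=1_X$; (RB4) $X\land 0=0$; (RB5) $X\geq Y$ implies $\neg(X\land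 1_Y)=\neg X\land 1_Y$. Modal algebras. $\mathsf{MRBA^k}$ is the class of pairs $(\mathbf{RB},f^k)$ with $\mathbf{RB}$ a relativized Boolean algebra and $f^k:RB\to RB$ satisfying: (f1) $f^k(1)=1$; (f2) $f^k(X\land Y)=f^k(X)\land f^k(Y)$; (fD) $f^k(0_X)=0_X$; (fk) $1_{f^k(X)}=1_X$. Define $f^A(X)=f^k(1_X)$. A homomorphism $h:\mathcal{L}(\mathbb{P})\to\mathbf{RB}$ extends to $h^+:\mathcal{L}^{A,K}(\mathbb{P})\to\mathbf{RB}$, respecting $1,\neg,\land$, by $h^+(A\phi)=f^A(h^+(\phi))$ and $h^+(K\phi)=f^k(h^+(\phi))$. $\mathsf{MRBA^k}\models\phi$ means: for all $(\mathbf{RB},f^k)\in\mathsf{MRBA^k}$ and all homomorphisms $h:\mathcal{L}(\mathbb{P})\to\mathbf{RB}$, $h^+(\phi)=1_X$ for some $X\in RB$. Awareness models. An ordered frame is a pre-ordered set $(W,\geq)$ with a serial binary relation $\mathrm{R}$ on $W$; $\mathrm{R}(\omega)=\{\omega'\mid\omega\mathrm{R}\omega'\}$. An awareness model is $M=(W,\geq,\mathrm{R},L,V)$ with $(W,\geq,\mathrm{R})$ an ordered frame and $L,V:\mathbb{P}\to\mathscr{P}(W)$ such that $L(p)$ is $\geq$-upward closed and $V(p)\subseteq L(p)$ for all $p$. The language at $\omega$ is $\mathcal{L}^{A,K}(\omega):=\mathcal{L}^{A,K}(\{p\in\mathbb{P}\mid\omega\in L(p)\})$. Truth at $\omega$ is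 defined only for formulas $\phi\in\mathcal{L}^{A,K}(\omega)$ (a formula outside $\mathcal{L}^{A,K}(\omega)$ is not modeled at $\omega$: $\langle M,\omega\rangle\not\models\phi$), and for formulas in $\mathcal{L}^{A,K}(\omega)$ recursively by: $\langle M,\omega\rangle\models 1$ always; $\langle M,\omega\rangle\models p$ iff $\omega\in V(p)$; $\langle M,\omega\rangle\models\neg\phi$ iff $\langle M,\omega\rangle\not\models\phi$; $\langle M,\omega\rangle\models\phi\land\psi$ iff $\langle M,\omega\rangle\models\phi$ and $\langle M,\omega\rangle\models\psi$; $\langle M,\omega\rangle\models A\phi$ iff $\phi\in\mathcal{L}^{A,K}(\omega')$ for all $\omega'\in\mathrm{R}(\omega)$; $\langle M,\omega\rangle\models K\phi$ iff $\langle M,\omega'\rangle\models\phi$ for all $\omega'\in\mathrm{R}(\omega)$. Put $V(\phi)=\{\omega\mid\langle M,\omega\rangle\models\phi\}$ and $L(\phi)=\{\omega\mid\phi\in\mathcal{L}^{A,K}(\omega)\}$. $\phi$ is valid in $M$ if $V(\phi)=L(\phi)$, and $\mathsf{AM}\models\phi$ means $\phi$ is valid in every awareness model. -}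

module Defs where

open import Level using (Level; suc; _⊔_)
open import Algebra.Core using (Op₁; Op₂)
import Algebra.Definitions as AlgebraDefs
import Algebra.Morphism.Definitions as MorphismDefs
open import Data.Product.Base using (∃; _×_)
open import Data.Unit.Polymorphic.Base using (⊤)
import Relation.Nullary.Negation.Core as Negation
open import Relation.Binary.Core using (Rel)
open import Relation.Binary.Structures using (IsEquivalence; IsPreorder)
open import Relation.Binary.Morphism.Structures using (IsRelHomomorphism)
open import Relation.Binary.PropositionalEquality.Core using (_≡_)
import Relation.Binary.PropositionalEquality as ≡
open import Relation.Unary using (Pred; _∈_; _⊆_; _≐_)

private
  variable
    a c ℓ c₁ ℓ₁ c₂ ℓ₂ : Level

infix  8 ¬̇_
infixr 7 _∧̇_

------------------------------------------------------------------------
-- Languages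

data ℒ (P : Set a) : Set a where
  var  : P → ℒ P
  𝟏    : ℒ P
  ¬̇_   : ℒ P → ℒ P
  _∧̇_  : ℒ P → ℒ P → ℒ P

data ℒᴬᴷ (P : Set a) : Set a where
  var  : P → ℒᴬᴷ P
  𝟏    : ℒᴬᴷ P
  ¬̇_   : ℒᴬᴷ P → ℒᴬᴷ P
  _∧̇_  : ℒᴬᴷ P → ℒᴬᴷ P → ℒᴬᴷ P
  A K  : ℒᴬᴷ P → ℒᴬᴷ P

-- ℒᴬᴷ[ Q ] is the language ℒᴬᴷ over the subset Q of P, as a subset of ℒᴬᴷ P.
data ℒᴬᴷ[_] {P : Set a} (Q : Pred P ℓ) : Pred (ℒᴬᴷ P) (a ⊔ ℓ) where
  var  : ∀ {p} → p ∈ Q → var p ∈ ℒᴬᴷ[ Q ]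
  𝟏    : 𝟏 ∈ ℒᴬᴷ[ Q ]
  ¬̇_   : ∀ {φ} → φ ∈ ℒᴬᴷ[ Q ] → ¬̇ φ ∈ ℒᴬᴷ[ Q ]
  _∧̇_  : ∀ {φ ψ} → φ ∈ ℒᴬᴷ[ Q ] → ψ ∈ ℒᴬᴷ[ Q ] → φ ∧̇ ψ ∈ ℒᴬᴷ[ Q ]
  A    : ∀ {φ} → φ ∈ ℒᴬᴷ[ Q ] → A φ ∈ ℒᴬᴷ[ Q ]
  K    : ∀ {φ} → φ ∈ ℒᴬᴷ[ Q ] → K φ ∈ ℒᴬᴷ[ Q ]

------------------------------------------------------------------------
-- Algebras of Boolean similarity type

-- The carrier is a setoid; its _≈_ plays the role of equality.
record BooleanTypeAlgebra c ℓ : Set (suc (c ⊔ ℓ)) where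
  infix  8 ¬_
  infixr 7 _∧_
  infixr 6 _∨_
  infix  4 _≈_
  field
    Carrier       : Set c
    _≈_           : Rel Carrier ℓ
    _∧_ _∨_       : Op₂ Carrier
    ¬_            : Op₁ Carrier
    𝟘 𝟙           : Carrier
    isEquivalence : IsEquivalence _≈_

  open AlgebraDefs _≈_
  field
    ∧-cong : Congruent₂ _∧_
    ∨-cong : Congruent₂ _∨_
    ¬-cong : Congruent₁ ¬_

  infix 4 _≥_

  1[_] : Op₁ Carrier
  1[ X ] = X ∨ ¬ X

  0[_] : Op₁ Carrier
  0[ X ] = X ∧ ¬ X

  _≥_ : Rel Carrier ℓ
  Y ≥ X = X ∧ Y ≈ X

-- Preservation of 𝟘 is deliberately not required.
record Homomorphism (𝔸 : BooleanTypeAlgebra c₁ ℓ₁) (𝔹 : BooleanTypeAlgebra c₂ ℓ₂)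
       : Set (c₁ ⊔ ℓ₁ ⊔ c₂ ⊔ ℓ₂) where
  private
    module 𝔸 = BooleanTypeAlgebra 𝔸
    module 𝔹 = BooleanTypeAlgebra 𝔹
  open MorphismDefs 𝔸.Carrier 𝔹.Carrier 𝔹._≈_
  field
    ⟦_⟧               : 𝔸.Carrier → 𝔹.Carrier
    isRelHomomorphism : IsRelHomomorphism 𝔸._≈_ 𝔹._≈_ ⟦_⟧
    𝟙-homo            : Homomorphic₀ ⟦_⟧ 𝔸.𝟙 𝔹.𝟙
    ∧-homo            : Homomorphic₂ ⟦_⟧ 𝔸._∧_ 𝔹._∧_
    ∨-homo            : Homomorphic₂ ⟦_⟧ 𝔸._∨_ 𝔹._∨_
    ¬-homo            : Homomorphic₁ ⟦_⟧ 𝔸.¬_ 𝔹.¬_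

ℒ-algebra : Set a → BooleanTypeAlgebra a a
ℒ-algebra P = record
  { Carrier       = ℒ P
  ; _≈_           = _≡_
  ; _∧_           = _∧̇_
  ; _∨_           = λ φ ψ → ¬̇ ((¬̇ φ) ∧̇ (¬̇ ψ))
  ; ¬_            = ¬̇_
  ; 𝟘             = ¬̇ 𝟏
  ; 𝟙             = 𝟏
  ; isEquivalence = ≡.isEquivalence
  ; ∧-cong        = ≡.cong₂ _∧̇_
  ; ∨-cong        = ≡.cong₂ λ φ ψ → ¬̇ ((¬̇ φ) ∧̇ (¬̇ ψ))
  ; ¬-cong        = ≡.cong ¬̇_
  }

------------------------------------------------------------------------
-- Relativized Boolean algebras

record IsRBA (𝔸 : BooleanTypeAlgebra c ℓ) : Set (c ⊔ ℓ) where
  open BooleanTypeAlgebra 𝔸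
  open AlgebraDefs _≈_
  field
    ∧-assoc         : Associative _∧_
    ∨-assoc         : Associative _∨_
    ∧-comm          : Commutative _∧_
    ∨-comm          : Commutative _∨_
    ∧-distrib-∨     : _∧_ DistributesOver _∨_
    ∨-distrib-∧     : _∨_ DistributesOver _∧_
    deMorgan-∧      : ∀ X Y → ¬ (X ∧ Y) ≈ ¬ X ∨ ¬ Y
    deMorgan-∨      : ∀ X Y → ¬ (X ∨ Y) ≈ ¬ X ∧ ¬ Y
    ∧-idem          : Idempotent _∧_
    ∨-idem          : Idempotent _∨_
    ∧-identityʳ     : RightIdentity 𝟙 _∧_
    ¬-involutive    : Involutive ¬_
    ∨-𝟙             : ∀ X → X ∨ 𝟙 ≈ 1[ X ]
    ∧-zeroʳ         : RightZero 𝟘 _∧_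
    ¬-relativized   : ∀ X Y → X ≥ Y → ¬ (X ∧ 1[ Y ]) ≈ ¬ X ∧ 1[ Y ]

record RBA c ℓ : Set (suc (c ⊔ ℓ)) where
  field
    algebra : BooleanTypeAlgebra c ℓ
    isRBA   : IsRBA algebra

  open BooleanTypeAlgebra algebra public
  open IsRBA isRBA public

record MRBAᵏ c ℓ : Set (suc (c ⊔ ℓ)) where
  field
    rba : RBA c ℓ

  open RBA rba public
  open AlgebraDefs _≈_

  field
    fᵏ      : Op₁ Carrier
    fᵏ-cong : Congruent₁ fᵏ
    f1      : fᵏ 𝟙 ≈ 𝟙
    f2      : ∀ X Y → fᵏ (X ∧ Y) ≈ fᵏ X ∧ fᵏ Y
    fD      : ∀ X → fᵏ 0[ X ] ≈ 0[ X ]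
    fk      : ∀ X → 1[ fᵏ X ] ≈ 1[ X ]

  fᴬ : Op₁ Carrier
  fᴬ X = fᵏ 1[ X ]

  _⁺ : {P : Set a} → Homomorphism (ℒ-algebra P) algebra → ℒᴬᴷ P → Carrier
  (h ⁺) (var p)  = Homomorphism.⟦ h ⟧ (var p)
  (h ⁺) 𝟏        = 𝟙
  (h ⁺) (¬̇ φ)    = ¬ (h ⁺) φ
  (h ⁺) (φ ∧̇ ψ)  = (h ⁺) φ ∧ (h ⁺) ψ
  (h ⁺) (A φ)    = fᴬ ((h ⁺) φ)
  (h ⁺) (K φ)    = fᵏ ((h ⁺) φ)

MRBAᵏ⊨_ : {P : Set ℓ} → ℒᴬᴷ P → Set (suc ℓ)
MRBAᵏ⊨_ {ℓ} {P} φ =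
  (𝔐 : MRBAᵏ ℓ ℓ) → let open MRBAᵏ 𝔐 in
  (h : Homomorphism (ℒ-algebra P) algebra) → ∃ λ X → (h ⁺) φ ≈ 1[ X ]

------------------------------------------------------------------------
-- Awareness models

record OrderedFrame ℓ : Set (suc ℓ) where
  infix 4 _≥_
  field
    W          : Set ℓ
    _≥_        : Rel W ℓ
    isPreorder : IsPreorder _≡_ _≥_
    R          : W → Pred W ℓ
    serial     : ∀ ω → ∃ λ ω′ → ω′ ∈ R ω

record AwarenessModel (P : Set ℓ) : Set (suc ℓ) where
  field
    frame : OrderedFrame ℓ

  open OrderedFrame frame public

  field
    L              : P → Pred W ℓ
    V              : P → Pred W ℓ
    L-upwardClosed : ∀ p {ω ω′} → ω′ ≥ ω → ω ∈ L p → ω′ ∈ L p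
    V⊆L            : ∀ p → V p ⊆ L p

module _ {P : Set ℓ} (M : AwarenessModel P) where
  open AwarenessModel M

  ℒᴬᴷ⟨_⟩ : W → Pred (ℒᴬᴷ P) ℓ
  ℒᴬᴷ⟨ ω ⟩ = ℒᴬᴷ[ (λ p → ω ∈ L p) ]

  -- Truth holds only within the language at ω, so the guard is imposed at
  -- every subformula; in the clause for ¬̇ it makes ¬̇ φ fail, like φ itself,
  -- when φ is outside the language.
  infix 4 _⊨_

  _⊨_   : W → ℒᴬᴷ P → Set ℓ
  Truth : W → ℒᴬᴷ P → Set ℓ

  ω ⊨ φ = φ ∈ ℒᴬᴷ⟨ ω ⟩ × Truth ω φ

  Truth ω (var p)  = ω ∈ V p
  Truth ω 𝟏        = ⊤
  Truth ω (¬̇ φ)    = Negation.¬ (ω ⊨ φ)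
  Truth ω (φ ∧̇ ψ)  = ω ⊨ φ × ω ⊨ ψ
  Truth ω (A φ)    = ∀ {ω′} → ω′ ∈ R ω → φ ∈ ℒᴬᴷ⟨ ω′ ⟩
  Truth ω (K φ)    = ∀ {ω′} → ω′ ∈ R ω → ω′ ⊨ φ

  V⟨_⟩ : ℒᴬᴷ P → Pred W ℓ
  V⟨ φ ⟩ ω = ω ⊨ φ

  L⟨_⟩ : ℒᴬᴷ P → Pred W ℓ
  L⟨ φ ⟩ ω = φ ∈ ℒᴬᴷ⟨ ω ⟩

AM⊨_ : {P : Set ℓ} → ℒᴬᴷ P → Set (suc ℓ)
AM⊨_ {P = P} φ = (M : AwarenessModel P) → V⟨_⟩ M φ ≐ L⟨_⟩ M φ

{-# OPTIONS --safe #-}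

-- Soundness: over an awareness model, the functions W → Maybe Bool with the
-- pointwise weak Kleene operations form a modal relativized Boolean algebra in
-- which φ takes the value "nothing" at ω exactly when φ is not in the language
-- at ω.  Excluded middle provides the values in Bool, which keep the carrier
-- at level ℓ.
--
-- Completeness: in a relativized Boolean algebra every 0[ X ] is X ∧ ¬ 𝟙 and
-- every 1[ X ] is X ∨ 𝟙, so φ is defined "below m" when m ≤ 1[ φ ], and m is
-- consistent when m ≰ ¬ 𝟙.  The worlds of the countermodel are the consistent
-- elements that decide each of the finitely many relevant values defined below
-- them; finiteness lets single elements and finite meets play the role of
-- ultrafilters, so that no choice principle is needed.

module Submission where

open import Defs
open import Algebra.Consequences.Propositional using (comm∧distrˡ⇒distrʳ)
open import Algebra.Core using (Op₁; Op₂)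
open import Algebra.Definitions
  using (Associative; Commutative; Idempotent; _DistributesOverˡ_)
open import Algebra.Lattice.Bundles using (Semilattice)
import Algebra.Lattice.Properties.BooleanAlgebra as BooleanAlgebraProperties
import Algebra.Lattice.Properties.Semilattice as SemilatticeProperties
open import Axiom.ExcludedMiddle using (ExcludedMiddle)
open import Data.Bool.Base using (Bool; true; false; not; if_then_else_)
import Data.Bool.Base as Bool
import Data.Bool.Properties as Bool
open import Data.List.Base using (List; []; _∷_; _++_)
open import Data.List.Membership.Propositional.Properties using (∈-++⁺ˡ; ∈-++⁺ʳ)
open import Data.List.Relation.Binary.Subset.Propositional using (_⊆_)
open import Data.List.Relation.Unary.All as All using (All; []; _∷_)
open import Data.List.Relation.Unary.Any using (here; there)
open import Data.Maybe.Base using (Maybe; just; nothing; map; zipWith)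
open import Data.Product.Base using (∃; _×_; _,_; proj₁; proj₂)
open import Data.Sum.Base using (_⊎_; inj₁; inj₂) renaming (map to ⊎-map)
open import Function.Base using (_∘_; id)
open import Function.Bundles using (_⇔_; mk⇔; Equivalence)
open import Level using (Level)
open import Relation.Binary.Lattice using (MeetSemilattice)
open import Relation.Binary.PropositionalEquality as ≡ using (_≡_; _≢_; refl; cong; cong₂)
import Relation.Binary.Reasoning.Setoid as ≈-Reasoning
open import Relation.Nullary using (¬_; Dec; yes; no; does; contradiction)
open import Relation.Nullary.Decidable
  using (dec-true; dec-false; does-⇔; _×-dec_; decidable-stable)
open import Relation.Unary using (_≐_)

private
  variable
    c ℓ : Level

-- Lifting identities along `zipWith`, with `nothing` absorbing.

module _ {a} {A : Set a} where

  zipWith-assoc : {f : Op₂ A} → Associative _≡_ f → Associative _≡_ (zipWith f)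
  zipWith-assoc assoc (just a) (just b) (just c) = cong just (assoc a b c)
  zipWith-assoc assoc (just a) (just b) nothing  = refl
  zipWith-assoc assoc (just a) nothing  z        = refl
  zipWith-assoc assoc nothing  y        z        = refl

  zipWith-comm : {f : Op₂ A} → Commutative _≡_ f → Commutative _≡_ (zipWith f)
  zipWith-comm comm (just a) (just b) = cong just (comm a b)
  zipWith-comm comm (just a) nothing  = refl
  zipWith-comm comm nothing  (just b) = refl
  zipWith-comm comm nothing  nothing  = refl

  zipWith-idem : {f : Op₂ A} → Idempotent _≡_ f → Idempotent _≡_ (zipWith f)
  zipWith-idem idem (just a) = cong just (idem a)
  zipWith-idem idem nothing  = refl

  zipWith-distribˡ : {f g : Op₂ A} → _DistributesOverˡ_ _≡_ f g →
                     _DistributesOverˡ_ _≡_ (zipWith f) (zipWith g)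
  zipWith-distribˡ distrib (just a) (just b) (just c) = cong just (distrib a b c)
  zipWith-distribˡ distrib (just a) (just b) nothing  = refl
  zipWith-distribˡ distrib (just a) nothing  z        = refl
  zipWith-distribˡ distrib nothing  y        z        = refl

  map-zipWith-homo : {f g : Op₂ A} {k : Op₁ A} → (∀ a b → k (f a b) ≡ g (k a) (k b)) →
                     ∀ x y → map k (zipWith f x y) ≡ zipWith g (map k x) (map k y)
  map-zipWith-homo homo (just a) (just b) = cong just (homo a b)
  map-zipWith-homo homo (just a) nothing  = refl
  map-zipWith-homo homo nothing  y        = refl

-- Order, definedness and consistency in relativized Boolean algebras.

module RBAProperties (𝔹 : RBA c ℓ) where
  open RBA 𝔹 renaming (¬_ to infix 8 ∼_; ¬-cong to ∼-cong; ¬-involutive to ∼-involutive)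
    hiding (_≥_)

  semilattice : Semilattice c ℓ
  semilattice = record
    { isSemilattice = record
      { isBand = record
        { isSemigroup = record
          { isMagma = record { isEquivalence = isEquivalence ; ∙-cong = ∧-cong }
          ; assoc = ∧-assoc
          }
        ; idem = ∧-idem
        }
      ; comm = ∧-comm
      }
    }

  open MeetSemilattice
    (SemilatticeProperties.∧-orderTheoreticMeetSemilattice semilattice) public
    using (_≤_; antisym; module Eq; x∧y≤x; x∧y≤y; ∧-greatest; ≤-respʳ-≈; ≤-respˡ-≈)
    renaming (refl to ≤-refl; trans to ≤-trans)
  open ≈-Reasoning (Semilattice.setoid semilattice)

  -- The De Morgan dual of `∨-𝟙` taken at `∼ x`.
  0[]≈∧∼𝟙 : ∀ x → 0[ x ] ≈ x ∧ ∼ 𝟙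
  0[]≈∧∼𝟙 x = begin
    x ∧ ∼ x          ≈⟨ ∧-cong (∼-involutive x) (∼-involutive (∼ x)) ⟨
    ∼ ∼ x ∧ ∼ ∼ ∼ x  ≈⟨ deMorgan-∨ (∼ x) (∼ ∼ x) ⟨
    ∼ (∼ x ∨ ∼ ∼ x)  ≈⟨ ∼-cong (∨-𝟙 (∼ x)) ⟨
    ∼ (∼ x ∨ 𝟙)      ≈⟨ deMorgan-∨ (∼ x) 𝟙 ⟩
    ∼ ∼ x ∧ ∼ 𝟙      ≈⟨ ∧-cong (∼-involutive x) Eq.refl ⟩
    x ∧ ∼ 𝟙          ∎

  1[∼] : ∀ x → 1[ ∼ x ] ≈ 1[ x ]
  1[∼] x = begin
    ∼ x ∨ ∼ ∼ x  ≈⟨ ∨-cong Eq.refl (∼-involutive x) ⟩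
    ∼ x ∨ x      ≈⟨ ∨-comm (∼ x) x ⟩
    x ∨ ∼ x      ∎

  1[∧] : ∀ x y → 1[ x ∧ y ] ≈ 1[ x ] ∧ 1[ y ]
  1[∧] x y = begin
    1[ x ∧ y ]           ≈⟨ ∨-𝟙 (x ∧ y) ⟨
    (x ∧ y) ∨ 𝟙          ≈⟨ proj₂ ∨-distrib-∧ 𝟙 x y ⟩
    (x ∨ 𝟙) ∧ (y ∨ 𝟙)    ≈⟨ ∧-cong (∨-𝟙 x) (∨-𝟙 y) ⟩
    1[ x ] ∧ 1[ y ]      ∎

  1[1[]] : ∀ x → 1[ 1[ x ] ] ≈ 1[ x ]
  1[1[]] x = begin
    1[ 1[ x ] ]    ≈⟨ ∨-𝟙 1[ x ] ⟨
    1[ x ] ∨ 𝟙     ≈⟨ ∨-cong (∨-𝟙 x) Eq.refl ⟨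
    (x ∨ 𝟙) ∨ 𝟙    ≈⟨ ∨-assoc x 𝟙 𝟙 ⟩
    x ∨ (𝟙 ∨ 𝟙)    ≈⟨ ∨-cong Eq.refl (∨-idem 𝟙) ⟩
    x ∨ 𝟙          ≈⟨ ∨-𝟙 x ⟩
    1[ x ]         ∎

  1[𝟙] : 1[ 𝟙 ] ≈ 𝟙
  1[𝟙] = Eq.trans (Eq.sym (∨-𝟙 𝟙)) (∨-idem 𝟙)

  1[]-cong : ∀ {x y} → x ≈ y → 1[ x ] ≈ 1[ y ]
  1[]-cong x≈y = ∨-cong x≈y (∼-cong x≈y)

  1[]-mono : ∀ {x y} → x ≤ y → 1[ x ] ≤ 1[ y ]
  1[]-mono {x} {y} x≤y = Eq.trans (1[]-cong x≤y) (1[∧] x y)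

  ≤𝟙 : ∀ x → x ≤ 𝟙
  ≤𝟙 x = Eq.sym (∧-identityʳ x)

  -- Absorption fails in general, but a join with `𝟙` is absorbed because `x ∧ 𝟙 ≈ x`.
  ≤1[] : ∀ x → x ≤ 1[ x ]
  ≤1[] x = begin
    x                    ≈⟨ ∨-idem x ⟨
    x ∨ x                ≈⟨ ∨-cong (∧-idem x) (∧-identityʳ x) ⟨
    (x ∧ x) ∨ (x ∧ 𝟙)    ≈⟨ proj₁ ∧-distrib-∨ x x 𝟙 ⟨
    x ∧ (x ∨ 𝟙)          ≈⟨ ∧-cong Eq.refl (∨-𝟙 x) ⟩
    x ∧ 1[ x ]           ∎

  0[]≤∼𝟙 : ∀ x → 0[ x ] ≤ ∼ 𝟙
  0[]≤∼𝟙 x = ≤-respˡ-≈ (Eq.sym (0[]≈∧∼𝟙 x)) (x∧y≤y x (∼ 𝟙))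

  ≤∼𝟙⇒≈0[] : ∀ {x} → x ≤ ∼ 𝟙 → x ≈ 0[ x ]
  ≤∼𝟙⇒≈0[] {x} x≤∼𝟙 = Eq.trans x≤∼𝟙 (Eq.sym (0[]≈∧∼𝟙 x))

  -- The bound is `∼ 𝟙` and not `𝟘`: contradictions `0[ x ]` lie below `∼ 𝟙` but need not lie below
  -- `𝟘`.
  Consistent : Carrier → Set ℓ
  Consistent x = ¬ x ≤ ∼ 𝟙

  consistent⇒¬both : ∀ {m x} → Consistent m → m ≤ x → ¬ m ≤ ∼ x
  consistent⇒¬both {x = x} con m≤x m≤∼x =
    con (≤-trans (∧-greatest m≤x m≤∼x) (0[]≤∼𝟙 x))

  -- Reductio. Definedness splits `y` into `y ∧ x` and `y ∧ ∼ x`; the second part equals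
  -- `(y ∧ x) ∧ ∼ 𝟙`, which the first absorbs.
  ∧∼≤∼𝟙⇒≤ : ∀ {x y} → y ≤ 1[ x ] → y ∧ ∼ x ≤ ∼ 𝟙 → y ≤ x
  ∧∼≤∼𝟙⇒≤ {x} {y} y≤1[x] y∧∼x≤∼𝟙 = begin
    y                                ≈⟨ y≤1[x] ⟩
    y ∧ (x ∨ ∼ x)                    ≈⟨ proj₁ ∧-distrib-∨ y x (∼ x) ⟩
    (y ∧ x) ∨ (y ∧ ∼ x)              ≈⟨ ∨-cong (Eq.sym (∧-identityʳ _)) y∧∼x≈ ⟩
    ((y ∧ x) ∧ 𝟙) ∨ ((y ∧ x) ∧ ∼ 𝟙)  ≈⟨ proj₁ ∧-distrib-∨ (y ∧ x) 𝟙 (∼ 𝟙) ⟨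
    (y ∧ x) ∧ 1[ 𝟙 ]                 ≈⟨ ∧-cong Eq.refl 1[𝟙] ⟩
    (y ∧ x) ∧ 𝟙                      ≈⟨ ∧-identityʳ _ ⟩
    y ∧ x                            ∎
    where
    y∧∼x≈ : y ∧ ∼ x ≈ (y ∧ x) ∧ ∼ 𝟙
    y∧∼x≈ = begin
      y ∧ ∼ x            ≈⟨ y∧∼x≤∼𝟙 ⟩
      (y ∧ ∼ x) ∧ ∼ 𝟙    ≈⟨ ∧-assoc y (∼ x) (∼ 𝟙) ⟩
      y ∧ (∼ x ∧ ∼ 𝟙)    ≈⟨ ∧-cong Eq.refl (0[]≈∧∼𝟙 (∼ x)) ⟨
      y ∧ (∼ x ∧ ∼ ∼ x)  ≈⟨ ∧-cong Eq.refl (∧-cong Eq.refl (∼-involutive x)) ⟩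
      y ∧ (∼ x ∧ x)      ≈⟨ ∧-cong Eq.refl (∧-comm (∼ x) x) ⟩
      y ∧ (x ∧ ∼ x)      ≈⟨ ∧-cong Eq.refl (0[]≈∧∼𝟙 x) ⟩
      y ∧ (x ∧ ∼ 𝟙)      ≈⟨ ∧-assoc y x (∼ 𝟙) ⟨
      (y ∧ x) ∧ ∼ 𝟙      ∎

  Decides : Carrier → Carrier → Set ℓ
  Decides m x = m ≤ 1[ x ] → m ≤ x ⊎ m ≤ ∼ x

  -- n lies below m in the same Boolean fibre { x | 1[ x ] ≈ i }.
  infix 4 _≼_
  _≼_ : Carrier → Carrier → Set _
  n ≼ m = n ≤ m × (∀ {x} → n ≤ 1[ x ] → m ≤ 1[ x ])

  ≼-refl : ∀ {m} → m ≼ m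
  ≼-refl = ≤-refl , id

  ≼-trans : ∀ {m n o} → o ≼ n → n ≼ m → o ≼ m
  ≼-trans (o≤n , defₒ) (n≤m , defₙ) = ≤-trans o≤n n≤m , defₙ ∘ defₒ

  -- With `≤` in place of `≼` this would break: a smaller element may have more values defined below
  -- it, hence more to decide.
  Decides-≼ : ∀ {m n x} → n ≼ m → Decides m x → Decides n x
  Decides-≼ (n≤m , def) dec n≤1[x] = ⊎-map (≤-trans n≤m) (≤-trans n≤m) (dec (def n≤1[x]))

  -- Apply `1[_]` to both sides of `m ∧ ∼ x ≤ 1[ z ]`: the left side becomes an element above `m`,
  -- as `m ≤ 1[ x ]`, and the right side does not change.
  ∧∼-≼ : ∀ {m x} → m ≤ 1[ x ] → m ∧ ∼ x ≼ m
  ∧∼-≼ {m} {x} m≤1[x] = x∧y≤x m (∼ x) , λ {z} m∧∼x≤1[z] →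
    ≤-trans (≤-trans m≤1[m∧∼x] (1[]-mono m∧∼x≤1[z])) (≤-respʳ-≈ (1[1[]] z) ≤-refl)
    where
    m≤1[m∧∼x] : m ≤ 1[ m ∧ ∼ x ]
    m≤1[m∧∼x] = ≤-respʳ-≈ (Eq.sym (1[∧] m (∼ x)))
      (∧-greatest (≤1[] m) (≤-respʳ-≈ (Eq.sym (1[∼] x)) m≤1[x]))

  module _ (em : ExcludedMiddle ℓ) where

    -- If `m ∧ ∼ x` is inconsistent, then `m` already lies below `x`; otherwise that meet decides
    -- `x` negatively.
    refine₁ : ∀ {m} → Consistent m → ∀ x → ∃ λ n → Consistent n × n ≼ m × Decides n x
    refine₁ {m} con x with em {m ≤ 1[ x ]} | em {m ∧ ∼ x ≤ ∼ 𝟙}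
    ... | no  m≰1[x] | _           = m , con , ≼-refl , λ m≤1[x] → contradiction m≤1[x] m≰1[x]
    ... | yes m≤1[x] | yes m∧∼x≤∼𝟙 = m , con , ≼-refl , λ _ → inj₁ (∧∼≤∼𝟙⇒≤ m≤1[x] m∧∼x≤∼𝟙)
    ... | yes m≤1[x] | no  con′    = m ∧ ∼ x , con′ , ∧∼-≼ m≤1[x] , λ _ → inj₂ (x∧y≤y m (∼ x))

    refine : ∀ {m} → Consistent m → ∀ xs → ∃ λ n → Consistent n × n ≼ m × All (Decides n) xs
    refine {m} con []       = m , con , ≼-refl , []
    refine     con (x ∷ xs) with refine₁ con x
    ... | n , conₙ , n≼m , decₙ with refine conₙ xs
    ... | o , conₒ , o≼n , decs = o , conₒ , ≼-trans o≼n n≼m , Decides-≼ o≼n decₙ ∷ decs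

-- Completeness: the finitary canonical model of an algebra.

module Countermodel {ℓ} (em : ExcludedMiddle ℓ) {P : Set ℓ} (𝔐 : MRBAᵏ ℓ ℓ)
  (h : Homomorphism (ℒ-algebra P) (MRBAᵏ.algebra 𝔐)) where

  open MRBAᵏ 𝔐 renaming (¬_ to infix 8 ∼_; ¬-cong to ∼-cong; ¬-involutive to ∼-involutive)
    hiding (_≥_)
  open RBAProperties rba

  fᵏ-mono : ∀ {x y} → x ≤ y → fᵏ x ≤ fᵏ y
  fᵏ-mono {x} {y} x≤y = Eq.trans (fᵏ-cong x≤y) (f2 x y)

  -- An element below `∼ 𝟙` is its own `0[_]`, which `fD` fixes. Seriality of the countermodel rests
  -- on this.
  fᵏ-inconsistent : ∀ {x} → x ≤ ∼ 𝟙 → fᵏ x ≤ ∼ 𝟙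
  fᵏ-inconsistent {x} x≤∼𝟙 =
    ≤-respˡ-≈ (Eq.sym (Eq.trans (fᵏ-cong (≤∼𝟙⇒≈0[] x≤∼𝟙)) (fD x))) (0[]≤∼𝟙 x)

  -- Finite stand-in for the filter of all `x` with `m ≤ fᵏ x`: `y` is the meet of those in `xs`,
  -- with `f1` for the empty meet and `f2` for each further factor.
  known-meet : ∀ m xs → ∃ λ y → m ≤ fᵏ y × All (λ x → m ≤ fᵏ x → y ≤ x) xs
  known-meet m []       = 𝟙 , ≤-respʳ-≈ (Eq.sym f1) (≤𝟙 m) , []
  known-meet m (x ∷ xs) with known-meet m xs | em {m ≤ fᵏ x}
  ... | y , m≤fy , ys | no  m≰fx = y , m≤fy , (λ m≤fx → contradiction m≤fx m≰fx) ∷ ys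
  ... | y , m≤fy , ys | yes m≤fx =
    x ∧ y , ≤-respʳ-≈ (Eq.sym (f2 x y)) (∧-greatest m≤fx m≤fy) ,
    (λ _ → x∧y≤x x y) ∷ All.map (≤-trans (x∧y≤y x y) ∘_) ys

  -- The values 1[ φ ] are included because A φ is interpreted as fᵏ 1[ φ ].
  values : ℒᴬᴷ P → List Carrier
  values φ = (h ⁺) φ ∷ 1[ (h ⁺) φ ] ∷ proper φ
    where
    proper : ℒᴬᴷ P → List Carrier
    proper (var p)  = []
    proper 𝟏        = []
    proper (¬̇ φ)    = values φ
    proper (φ ∧̇ ψ)  = values φ ++ values ψ
    proper (A φ)    = values φ
    proper (K φ)    = values φ

  module _ (xs : List Carrier) where

    record World : Set ℓ where
      field
        elem       : Carrier
        consistent : Consistent elem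
        decides    : All (Decides elem) xs
    open World

    infix 4 _↝_
    -- The canonical accessibility relation, restricted to the values in `xs`.
    _↝_ : World → World → Set ℓ
    m ↝ n = All (λ x → elem m ≤ fᵏ x → elem n ≤ x) xs

    world-≼ : ∀ {m} → Consistent m → ∃ λ n → elem n ≼ m
    world-≼ con with refine em con xs
    ... | n , conₙ , n≼m , dec =
      record { elem = n ; consistent = conₙ ; decides = dec } , n≼m

    -- The existence lemma of canonical models. Since `x` need not occur in `xs`, taking `x` to be
    -- `∼ 𝟙` yields seriality.
    successor : ∀ m {x} → ¬ elem m ≤ fᵏ x → ∃ λ n → m ↝ n × ¬ elem n ≤ x
    successor m {x} m≰fx with known-meet (elem m) xs
    ... | y , m≤fy , ys with em {y ≤ 1[ x ]}
    -- Here `n` avoids `x` by unawareness: refining `y` along `≼` makes no new value defined.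
    ...   | no y≰1[x] = n , All.map (≤-trans (proj₁ n≼y) ∘_) ys ,
                        λ n≤x → y≰1[x] (proj₂ n≼y (≤-trans n≤x (≤1[] x)))
      where
      y-consistent : Consistent y
      y-consistent y≤∼𝟙 = consistent m (≤-trans m≤fy (fᵏ-inconsistent y≤∼𝟙))
      n   = proj₁ (world-≼ y-consistent)
      n≼y = proj₂ (world-≼ y-consistent)
    -- Here `n` refutes `x`. Were `y ∧ ∼ x` inconsistent, `y ≤ x` would follow, and monotonicity
    -- would give `m ≤ fᵏ x`.
    ...   | yes y≤1[x] = n , All.map (≤-trans n≤y ∘_) ys ,
                         λ n≤x → consistent⇒¬both (consistent n) n≤x n≤∼x
      where
      y∧∼x-consistent : Consistent (y ∧ ∼ x)
      y∧∼x-consistent y∧∼x≤∼𝟙 =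
        m≰fx (≤-trans m≤fy (fᵏ-mono (∧∼≤∼𝟙⇒≤ y≤1[x] y∧∼x≤∼𝟙)))
      n    = proj₁ (world-≼ y∧∼x-consistent)
      n≤∧  = proj₁ (proj₂ (world-≼ y∧∼x-consistent))
      n≤y  = ≤-trans n≤∧ (x∧y≤x y (∼ x))
      n≤∼x = ≤-trans n≤∧ (x∧y≤y y (∼ x))

    -- Truth does not depend on the order, so the discrete one suffices.
    model : AwarenessModel P
    model = record
      { frame = record
        { W          = World
        ; _≥_        = _≡_
        ; isPreorder = ≡.isPreorder
        ; R          = _↝_
        ; serial     = λ m → let n , m↝n , _ = successor m (consistent m ∘ f∼𝟙) in n , m↝n
        }
      ; L              = λ p m → elem m ≤ 1[ (h ⁺) (var p) ]
      ; V              = λ p m → elem m ≤ (h ⁺) (var p)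
      ; L-upwardClosed = λ { _ refl m≤1[p] → m≤1[p] }
      ; V⊆L            = λ _ m≤p → ≤-trans m≤p (≤1[] _)
      }
      where
      f∼𝟙 : ∀ {m} → m ≤ fᵏ (∼ 𝟙) → m ≤ ∼ 𝟙
      f∼𝟙 m≤f∼𝟙 = ≤-trans m≤f∼𝟙 (fᵏ-inconsistent ≤-refl)

    -- `1[_]` passes through each connective as language membership does; for `A` and `K` this is
    -- `fk`.
    language⇒≤1[] : ∀ m {φ} → L⟨_⟩ model φ m → elem m ≤ 1[ (h ⁺) φ ]
    language⇒≤1[] m (var m≤1[p]) = m≤1[p]
    language⇒≤1[] m 𝟏            = ≤-trans (≤𝟙 _) (≤1[] 𝟙)
    language⇒≤1[] m (¬̇ l)        = ≤-respʳ-≈ (Eq.sym (1[∼] _)) (language⇒≤1[] m l)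
    language⇒≤1[] m (l ∧̇ l′)     =
      ≤-respʳ-≈ (Eq.sym (1[∧] _ _)) (∧-greatest (language⇒≤1[] m l) (language⇒≤1[] m l′))
    language⇒≤1[] m (A l)        =
      ≤-respʳ-≈ (Eq.sym (Eq.trans (fk _) (1[1[]] _))) (language⇒≤1[] m l)
    language⇒≤1[] m (K l)        = ≤-respʳ-≈ (Eq.sym (fk _)) (language⇒≤1[] m l)

    ≤1[]⇒language : ∀ m φ → elem m ≤ 1[ (h ⁺) φ ] → L⟨_⟩ model φ m
    ≤1[]⇒language m (var p) m≤ = var m≤
    ≤1[]⇒language m 𝟏       m≤ = 𝟏
    ≤1[]⇒language m (¬̇ φ)   m≤ = ¬̇ ≤1[]⇒language m φ (≤-respʳ-≈ (1[∼] _) m≤)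
    ≤1[]⇒language m (φ ∧̇ ψ) m≤ =
      ≤1[]⇒language m φ (≤-trans m≤∧ (x∧y≤x _ _)) ∧̇ ≤1[]⇒language m ψ (≤-trans m≤∧ (x∧y≤y _ _))
      where m≤∧ = ≤-respʳ-≈ (1[∧] _ _) m≤
    ≤1[]⇒language m (A φ)   m≤ = A (≤1[]⇒language m φ (≤-respʳ-≈ (Eq.trans (fk _) (1[1[]] _)) m≤))
    ≤1[]⇒language m (K φ)   m≤ = K (≤1[]⇒language m φ (≤-respʳ-≈ (fk _) m≤))

    -- The truth lemma. Its two directions are mutual because negation exchanges them, and `xs`
    -- stays fixed so that induction can move to other worlds.
    ⊨⇒≤ : ∀ m φ → values φ ⊆ xs → V⟨_⟩ model φ m → elem m ≤ (h ⁺) φ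
    ≤⇒⊨ : ∀ m φ → values φ ⊆ xs → elem m ≤ (h ⁺) φ → V⟨_⟩ model φ m

    ⊨⇒≤ m (var p) sub (_ , m≤p) = m≤p
    ⊨⇒≤ m 𝟏       sub _         = ≤𝟙 _
    ⊨⇒≤ m (¬̇ φ)   sub (¬̇ l , m⊭φ)
      -- The third entry of `values (¬̇ φ)` is the value of `φ`, which `m` therefore decides.
      with All.lookup (decides m) (sub (there (there (here refl)))) (language⇒≤1[] m l)
    ... | inj₁ m≤φ  = contradiction (≤⇒⊨ m φ (sub ∘ there ∘ there) m≤φ) m⊭φ
    ... | inj₂ m≤∼φ = m≤∼φ
    ⊨⇒≤ m (φ ∧̇ ψ) sub (_ , m⊨φ , m⊨ψ) = ∧-greatest
      (⊨⇒≤ m φ (sub ∘ there ∘ there ∘ ∈-++⁺ˡ) m⊨φ)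
      (⊨⇒≤ m ψ (sub ∘ there ∘ there ∘ ∈-++⁺ʳ (values φ)) m⊨ψ)
    ⊨⇒≤ m (A φ)   sub (_ , aware) = decidable-stable em λ m≰f1[φ] →
      let n , m↝n , n≰1[φ] = successor m m≰f1[φ] in
      n≰1[φ] (language⇒≤1[] n (aware {n} m↝n))
    ⊨⇒≤ m (K φ)   sub (_ , knows) = decidable-stable em λ m≰fφ →
      let n , m↝n , n≰φ = successor m m≰fφ in
      n≰φ (⊨⇒≤ n φ (sub ∘ there ∘ there) (knows m↝n))

    ≤⇒⊨ m φ sub m≤φ = ≤1[]⇒language m φ (≤-trans m≤φ (≤1[] _)) , truth φ sub m≤φ
      where
      truth : ∀ φ → values φ ⊆ xs → elem m ≤ (h ⁺) φ → Truth model m φ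
      truth (var p) sub m≤p      = m≤p
      truth 𝟏       sub _        = _
      truth (¬̇ φ)   sub m≤∼φ m⊨φ =
        consistent⇒¬both (consistent m) (⊨⇒≤ m φ (sub ∘ there ∘ there) m⊨φ) m≤∼φ
      truth (φ ∧̇ ψ) sub m≤φ∧ψ    =
        ≤⇒⊨ m φ (sub ∘ there ∘ there ∘ ∈-++⁺ˡ) (≤-trans m≤φ∧ψ (x∧y≤x _ _)) ,
        ≤⇒⊨ m ψ (sub ∘ there ∘ there ∘ ∈-++⁺ʳ (values φ)) (≤-trans m≤φ∧ψ (x∧y≤y _ _))
      -- The fourth entry of `values (A φ)` is `1[ (h ⁺) φ ]`, so `↝` transmits it to `n`.
      truth (A φ)   sub m≤f1[φ] {n} m↝n =
        ≤1[]⇒language n φ (All.lookup m↝n (sub (there (there (there (here refl))))) m≤f1[φ])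
      truth (K φ)   sub m≤fφ {n} m↝n =
        ≤⇒⊨ n φ (sub ∘ there ∘ there) (All.lookup m↝n (sub (there (there (here refl)))) m≤fφ)

  -- Otherwise `1[ x ] ∧ ∼ x` is consistent, and a world below it has `φ` in its language yet
  -- refutes it.
  valid⇒≈1[] : ∀ {φ} → AM⊨ φ → (h ⁺) φ ≈ 1[ (h ⁺) φ ]
  valid⇒≈1[] {φ} valid = antisym (≤1[] _) (∧∼≤∼𝟙⇒≤ ≤-refl (decidable-stable em unrefuted))
    where
    x  = (h ⁺) φ
    xs = values φ
    unrefuted : ¬ Consistent (1[ x ] ∧ ∼ x)
    unrefuted con with world-≼ xs con
    ... | m , m≤ , _ = consistent⇒¬both (World.consistent m)
      (⊨⇒≤ xs m φ id (proj₂ (valid (model xs)) (≤1[]⇒language xs m φ (≤-trans m≤ (x∧y≤x _ _)))))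
      (≤-trans m≤ (x∧y≤y _ _))

-- Soundness: the algebra of an awareness model.

module ModelAlgebra {ℓ} (em : ExcludedMiddle ℓ) {P : Set ℓ} (M : AwarenessModel P) where

  open AwarenessModel M

  infixr 7 _∧₃_
  infixr 6 _∨₃_
  infix  8 ¬₃_

  _∧₃_ _∨₃_ : Maybe Bool → Maybe Bool → Maybe Bool
  _∧₃_ = zipWith Bool._∧_
  _∨₃_ = zipWith Bool._∨_

  ¬₃_ : Maybe Bool → Maybe Bool
  ¬₃_ = map not

  algebra : BooleanTypeAlgebra ℓ ℓ
  algebra = record
    { Carrier       = W → Maybe Bool
    ; _≈_           = λ X Y → ∀ ω → X ω ≡ Y ω
    ; _∧_           = λ X Y ω → X ω ∧₃ Y ω
    ; _∨_           = λ X Y ω → X ω ∨₃ Y ω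
    ; ¬_            = λ X ω → ¬₃ X ω
    -- `∧-zeroʳ` forces `nothing`: `just false` does not absorb `nothing`.
    ; 𝟘             = λ _ → nothing
    ; 𝟙             = λ _ → just true
    ; isEquivalence = record
      { refl  = λ _ → refl
      ; sym   = λ X≈Y ω → ≡.sym (X≈Y ω)
      ; trans = λ X≈Y Y≈Z ω → ≡.trans (X≈Y ω) (Y≈Z ω)
      }
    ; ∧-cong        = λ X≈X′ Y≈Y′ ω → cong₂ _∧₃_ (X≈X′ ω) (Y≈Y′ ω)
    ; ∨-cong        = λ X≈X′ Y≈Y′ ω → cong₂ _∨₃_ (X≈X′ ω) (Y≈Y′ ω)
    ; ¬-cong        = λ X≈X′ ω → cong ¬₃_ (X≈X′ ω)
    }

  private module BoolAlgebra = BooleanAlgebraProperties Bool.∨-∧-booleanAlgebra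

  isRBA : IsRBA algebra
  isRBA = record
    { ∧-assoc       = λ X Y Z ω → zipWith-assoc Bool.∧-assoc (X ω) (Y ω) (Z ω)
    ; ∨-assoc       = λ X Y Z ω → zipWith-assoc Bool.∨-assoc (X ω) (Y ω) (Z ω)
    ; ∧-comm        = λ X Y ω → zipWith-comm Bool.∧-comm (X ω) (Y ω)
    ; ∨-comm        = λ X Y ω → zipWith-comm Bool.∨-comm (X ω) (Y ω)
    ; ∧-distrib-∨   =
        (λ X Y Z ω → zipWith-distribˡ Bool.∧-distribˡ-∨ (X ω) (Y ω) (Z ω)) ,
        (λ X Y Z ω → comm∧distrˡ⇒distrʳ (zipWith-comm Bool.∧-comm)
          (zipWith-distribˡ Bool.∧-distribˡ-∨) (X ω) (Y ω) (Z ω))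
    ; ∨-distrib-∧   =
        (λ X Y Z ω → zipWith-distribˡ Bool.∨-distribˡ-∧ (X ω) (Y ω) (Z ω)) ,
        (λ X Y Z ω → comm∧distrˡ⇒distrʳ (zipWith-comm Bool.∨-comm)
          (zipWith-distribˡ Bool.∨-distribˡ-∧) (X ω) (Y ω) (Z ω))
    ; deMorgan-∧    = λ X Y ω → map-zipWith-homo BoolAlgebra.deMorgan₁ (X ω) (Y ω)
    ; deMorgan-∨    = λ X Y ω → map-zipWith-homo BoolAlgebra.deMorgan₂ (X ω) (Y ω)
    ; ∧-idem        = λ X ω → zipWith-idem Bool.∧-idem (X ω)
    ; ∨-idem        = λ X ω → zipWith-idem Bool.∨-idem (X ω)
    ; ∧-identityʳ   = λ X ω → ∧₃-identityʳ (X ω)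
    ; ¬-involutive  = λ X ω → ¬₃-involutive (X ω)
    ; ∨-𝟙           = λ X ω → ∨₃-true (X ω)
    ; ∧-zeroʳ       = λ X ω → zipWith-comm Bool.∧-comm (X ω) nothing
    ; ¬-relativized = λ X Y _ ω → ¬₃-relativized (X ω) (Y ω)
    }
    where
    ∧₃-identityʳ : ∀ x → x ∧₃ just true ≡ x
    ∧₃-identityʳ (just a) = cong just (Bool.∧-identityʳ a)
    ∧₃-identityʳ nothing  = refl

    ¬₃-involutive : ∀ x → ¬₃ ¬₃ x ≡ x
    ¬₃-involutive (just a) = cong just (Bool.not-involutive a)
    ¬₃-involutive nothing  = refl

    ∨₃-true : ∀ x → x ∨₃ just true ≡ x ∨₃ ¬₃ x
    ∨₃-true (just true)  = refl
    ∨₃-true (just false) = refl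
    ∨₃-true nothing      = refl

    ¬₃-relativized : ∀ x y → ¬₃ (x ∧₃ (y ∨₃ ¬₃ y)) ≡ ¬₃ x ∧₃ (y ∨₃ ¬₃ y)
    ¬₃-relativized (just true)  (just true)  = refl
    ¬₃-relativized (just true)  (just false) = refl
    ¬₃-relativized (just false) (just true)  = refl
    ¬₃-relativized (just false) (just false) = refl
    ¬₃-relativized (just a)     nothing      = refl
    ¬₃-relativized nothing      y            = refl

  □ : (W → Maybe Bool) → W → Set ℓ
  □ X ω = ∀ ω′ → R ω ω′ → X ω′ ≡ just true

  -- Changing the truth value but not the domain is what gives `fk`.
  guard : Bool → Maybe Bool → Maybe Bool
  guard b = map (λ _ → b)

  modalAlgebra : MRBAᵏ ℓ ℓ
  modalAlgebra = record
    { rba     = record { algebra = algebra ; isRBA = isRBA }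
    ; fᵏ      = fᵏ
    ; fᵏ-cong = fᵏ-cong
    ; f1      = λ ω → cong just (dec-true em λ _ _ → refl)
    ; f2      = f2
    ; fD      = fD
    ; fk      = λ X ω → fk _ (X ω)
    }
    where
    open BooleanTypeAlgebra algebra hiding (¬_)

    fᵏ : Op₁ Carrier
    fᵏ X ω = guard (does (em {□ X ω})) (X ω)

    fᵏ-cong : ∀ {X Y} → X ≈ Y → fᵏ X ≈ fᵏ Y
    fᵏ-cong X≈Y ω = cong₂ guard
      (does-⇔ (mk⇔ (λ □X ω′ r → ≡.trans (≡.sym (X≈Y ω′)) (□X ω′ r))
                   (λ □Y ω′ r → ≡.trans (X≈Y ω′) (□Y ω′ r))) em em)
      (X≈Y ω)

    ∧₃-true : ∀ x y → x ∧₃ y ≡ just true → x ≡ just true × y ≡ just true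
    ∧₃-true (just true) (just true) _ = refl , refl

    ∧₃-¬₃-≢true : ∀ x → x ∧₃ ¬₃ x ≢ just true
    ∧₃-¬₃-≢true (just true)  ()
    ∧₃-¬₃-≢true (just false) ()

    f2 : ∀ X Y → fᵏ (X ∧ Y) ≈ fᵏ X ∧ fᵏ Y
    f2 X Y ω with X ω | Y ω
    ... | nothing | _       = refl
    ... | just _  | nothing = refl
    -- `does` of a product decision is the conjunction of the two `does`, so an equivalence of
    -- propositions suffices.
    ... | just _  | just _  = cong just (does-⇔ (mk⇔
      (λ □X∧Y → (λ ω′ r → proj₁ (∧₃-true (X ω′) (Y ω′) (□X∧Y ω′ r))) ,
                (λ ω′ r → proj₂ (∧₃-true (X ω′) (Y ω′) (□X∧Y ω′ r))))
      (λ (□X , □Y) ω′ r → cong₂ _∧₃_ (□X ω′ r) (□Y ω′ r)))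
      em (em {□ X ω} ×-dec em {□ Y ω}))

    fD : ∀ X → fᵏ 0[ X ] ≈ 0[ X ]
    fD X ω with X ω
    ... | nothing = refl
    ... | just b  = cong just (≡.trans (dec-false em ¬□0[X]) (≡.sym (Bool.∧-inverseʳ b)))
      where
      ¬□0[X] : ¬ □ 0[ X ] ω
      -- A contradiction is true at no world, so seriality falsifies its box.
      ¬□0[X] □0[X] = let ω′ , r = serial ω in ∧₃-¬₃-≢true (X ω′) (□0[X] ω′ r)

    fk : ∀ b x → guard b x ∨₃ ¬₃ guard b x ≡ x ∨₃ ¬₃ x
    fk b (just a) = cong just (≡.trans (Bool.∨-inverseʳ b) (≡.sym (Bool.∨-inverseʳ a)))
    fk b nothing  = refl

  open MRBAᵏ modalAlgebra using (1[_]; _⁺)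

  valuation : P → W → Maybe Bool
  valuation p ω = if does (em {L p ω}) then just (does (em {V p ω})) else nothing

  eval : ℒ P → W → Maybe Bool
  eval (var p)  ω = valuation p ω
  eval 𝟏        ω = just true
  eval (¬̇ φ)    ω = ¬₃ eval φ ω
  eval (φ ∧̇ ψ)  ω = eval φ ω ∧₃ eval ψ ω

  evalHomomorphism : Homomorphism (ℒ-algebra P) algebra
  evalHomomorphism = record
    { ⟦_⟧               = eval
    ; isRelHomomorphism = record { cong = λ { refl ω → refl } }
    ; 𝟙-homo            = λ ω → refl
    ; ∧-homo            = λ φ ψ ω → refl
    ; ∨-homo            = λ φ ψ ω → ¬₃-∨₃ (eval φ ω) (eval ψ ω)
    ; ¬-homo            = λ φ ω → refl
    }
    where
    ¬₃-∨₃ : ∀ x y → ¬₃ (¬₃ x ∧₃ ¬₃ y) ≡ x ∨₃ y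
    ¬₃-∨₃ (just true)  (just b) = refl
    ¬₃-∨₃ (just false) (just b) = cong just (Bool.not-involutive b)
    ¬₃-∨₃ (just a)     nothing  = refl
    ¬₃-∨₃ nothing      y        = refl

  ⟦_⟧ : ℒᴬᴷ P → W → Maybe Bool
  ⟦_⟧ = evalHomomorphism ⁺

  -- Indexing by the value lets a match on the status fix the value too.
  data Status (ω : W) (φ : ℒᴬᴷ P) : Maybe Bool → Set ℓ where
    undefined : ¬ L⟨_⟩ M φ ω → Status ω φ nothing
    holds     : V⟨_⟩ M φ ω → Status ω φ (just true)
    fails     : L⟨_⟩ M φ ω → ¬ V⟨_⟩ M φ ω → Status ω φ (just false)

  holds⇒true : ∀ {ω φ x} → Status ω φ x → V⟨_⟩ M φ ω → x ≡ just true
  holds⇒true (undefined ¬l) (l , _) = contradiction l ¬l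
  holds⇒true (holds _)      _       = refl
  holds⇒true (fails _ ¬v)   v       = contradiction v ¬v

  true⇒holds : ∀ {ω φ x} → Status ω φ x → x ≡ just true → V⟨_⟩ M φ ω
  true⇒holds (holds v) refl = v

  language⇒true : ∀ {ω φ x} → Status ω φ x → L⟨_⟩ M φ ω → x ∨₃ ¬₃ x ≡ just true
  language⇒true (undefined ¬l) l = contradiction l ¬l
  language⇒true (holds _)      _ = refl
  language⇒true (fails _ _)    _ = refl

  true⇒language : ∀ {ω φ x} → Status ω φ x → x ∨₃ ¬₃ x ≡ just true → L⟨_⟩ M φ ω
  true⇒language (holds (l , _)) _ = l
  true⇒language (fails l _)     _ = l

  status-decide : ∀ {ω φ} {Q : Set ℓ} → Q ⇔ Truth M ω φ → (q : Dec Q) →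
                  L⟨_⟩ M φ ω → Status ω φ (just (does q))
  status-decide Q⇔φ (yes t) l = holds (l , Equivalence.to Q⇔φ t)
  status-decide Q⇔φ (no ¬t) l = fails l (¬t ∘ Equivalence.from Q⇔φ ∘ proj₂)

  -- Shared by `A` and `K`, which keep the language of their argument and change only its truth
  -- value.
  status-guard : ∀ {ω φ ψ x} {Q : Set ℓ} → L⟨_⟩ M φ ω ⇔ L⟨_⟩ M ψ ω → Q ⇔ Truth M ω ψ →
                 (q : Dec Q) → Status ω φ x → Status ω ψ (guard (does q) x)
  status-guard φ⇔ψ Q⇔ψ q (undefined ¬l)  = undefined (¬l ∘ Equivalence.from φ⇔ψ)
  status-guard φ⇔ψ Q⇔ψ q (holds (l , _)) = status-decide Q⇔ψ q (Equivalence.to φ⇔ψ l)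
  status-guard φ⇔ψ Q⇔ψ q (fails l _)     = status-decide Q⇔ψ q (Equivalence.to φ⇔ψ l)

  status : ∀ φ ω → Status ω φ (⟦ φ ⟧ ω)
  status (var p) ω with em {L p ω} | em {V p ω}
  ... | no ¬l | _     = undefined λ { (var l) → ¬l l }
  ... | yes l | yes t = holds (var l , t)
  ... | yes l | no ¬t = fails (var l) (¬t ∘ proj₂)
  status 𝟏       ω = holds (𝟏 , _)
  status (¬̇ φ)   ω with ⟦ φ ⟧ ω | status φ ω
  ... | _ | undefined ¬l    = undefined λ { (¬̇ l) → ¬l l }
  ... | _ | holds v@(l , _) = fails (¬̇ l) λ (_ , ¬v) → ¬v v
  ... | _ | fails l ¬v      = holds (¬̇ l , ¬v)
  status (φ ∧̇ ψ) ω with ⟦ φ ⟧ ω | status φ ω | ⟦ ψ ⟧ ω | status ψ ω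
  ... | _ | undefined ¬l    | _ | _                 = undefined λ { (l ∧̇ _) → ¬l l }
  ... | _ | holds _         | _ | undefined ¬l      = undefined λ { (_ ∧̇ l) → ¬l l }
  ... | _ | fails _ _       | _ | undefined ¬l      = undefined λ { (_ ∧̇ l) → ¬l l }
  ... | _ | holds v@(l , _) | _ | holds v′@(l′ , _) = holds (l ∧̇ l′ , v , v′)
  ... | _ | holds (l , _)   | _ | fails l′ ¬v′      = fails (l ∧̇ l′) λ (_ , _ , v′) → ¬v′ v′
  ... | _ | fails l ¬v      | _ | holds (l′ , _)    = fails (l ∧̇ l′) λ (_ , v , _) → ¬v v
  ... | _ | fails l ¬v      | _ | fails l′ _        = fails (l ∧̇ l′) λ (_ , v , _) → ¬v v
  -- `fᴬ` guards `1[ ⟦ φ ⟧ ]`, while the status at hand is that of `⟦ φ ⟧`; `guard` sees only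
  -- definedness, which agrees.
  status (A φ)   ω = ≡.subst (Status ω (A φ)) (guard-1[] (⟦ φ ⟧ ω))
    (status-guard (mk⇔ A λ { (A l) → l })
      (mk⇔ (λ □1 {ω′} r → true⇒language (status φ ω′) (□1 ω′ r))
           (λ aware ω′ r → language⇒true (status φ ω′) (aware r)))
      em (status φ ω))
    where
    guard-1[] : ∀ {b} x → guard b x ≡ guard b (x ∨₃ ¬₃ x)
    guard-1[] (just _) = refl
    guard-1[] nothing  = refl
  status (K φ)   ω = status-guard (mk⇔ K λ { (K l) → l })
    (mk⇔ (λ □φ {ω′} r → true⇒holds (status φ ω′) (□φ ω′ r))
         (λ knows ω′ r → holds⇒true (status φ ω′) (knows r)))
    em (status φ ω)

  -- `1[ X ]` never takes the value `just false`, so the status `fails` cannot occur.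
  ≈1[]⇒valid : ∀ {φ} → (∃ λ X → ∀ ω → ⟦ φ ⟧ ω ≡ 1[ X ] ω) → V⟨_⟩ M φ ≐ L⟨_⟩ M φ
  ≈1[]⇒valid {φ} (X , φ≈1[X]) = proj₁ , λ {ω} → never-fails (X ω) (φ≈1[X] ω) (status φ ω)
    where
    never-fails : ∀ {ω x} y → x ≡ y ∨₃ ¬₃ y → Status ω φ x → L⟨_⟩ M φ ω → V⟨_⟩ M φ ω
    never-fails y            _  (undefined ¬l) l = contradiction l ¬l
    never-fails y            _  (holds v)      _ = v
    never-fails (just true)  () (fails _ _)    _
    never-fails (just false) () (fails _ _)    _

theorem4 : ∀ {ℓ} → ExcludedMiddle ℓ → (P : Set ℓ) (φ : ℒᴬᴷ P) → (MRBAᵏ⊨ φ) ⇔ (AM⊨ φ)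
theorem4 em P φ = mk⇔
  (λ valid M → let open ModelAlgebra em M in ≈1[]⇒valid {φ} (valid modalAlgebra evalHomomorphism))
  -- The witness is the value of `φ` itself.
  (λ valid 𝔐 h → _ , Countermodel.valid⇒≈1[] em 𝔐 h {φ} valid)
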